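{- There is a single total computable function $d:\mathbb{N}\to\mathbb{N}$ which satisfies, with $\delta_a:=d(a)$, $\delta_a\in\mathbf{M}\iff\varphi_a(\delta_a)\!\downarrow=1$ for every $a$, and such that the same $d$ satisfies, for every index $a$ and every oracle $X\subseteq\mathbb{N}$: $$\delta_a\in\mathbf{M}^X\iff\varphi^X_a(\delta_a)\!\downarrow=1,$$ and exactly one of the following holds: (i) $\varphi^X_a(\delta_a)\!\downarrow=1$; (ii) $\varphi^X_a(\delta_a)\!\downarrow\neq1$; (iii) $\varphi^X_a(\delta_a)\!\uparrow$; where (i) refutes soundness, (ii) refutes exhaustiveness and (iii) refutes totality of the adjudicator $\varphi^X_a$ over the $X$-standard domain. Hence for every oracle $X$, no $X$-computable adjudicator over the $X$-standard domain is simultaneously total, exhaustive, and sound.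
   Context: $(\varphi_e)_{e\in\mathbb{N}}$ is the standard acceptable numbering of the unary partial computable functions and $\mathbf{M}=\{p:\varphi_p(0)\!\downarrow=1\}$. For $X\subseteq\mathbb{N}$, $(\varphi^X_e)_{e\in\mathbb{N}}$ is the standard enumeration of the unary $X$-partial computable functions, where $e$ codes the text of an oracle program and does not depend on $X$. Put $\mathbf{M}^X=\{p:\varphi^X_p(0)\!\downarrow=1\}$; the $X$-standard domain is $(\mathbb{N},\mathbf{M}^X)$. An $X$-computable adjudicator is an index $a$ acting through $\varphi^X_a$; it annuls $p$ if $\varphi^X_a(p)\!\downarrow=1$. It is total if $\varphi^X_a(p)\!\downarrow$ for all $p$; exhaustive if it annuls every $p\in\mathbb{N}$; sound if $\varphi^X_a(p)\!\downarrow=1$ implies $p\notin\mathbf{M}^X$ for all $p$. -}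

module Defs where

open import Data.Nat.Base using (ℕ; zero; suc; _+_; _<_)
open import Data.Product.Base using (_×_; _,_; proj₁; proj₂; ∃; ∃-syntax)
open import Data.Sum.Base using (_⊎_)
open import Level using (0ℓ; Level; _⊔_)
open import Relation.Binary.Core using (Rel)
open import Relation.Binary.PropositionalEquality.Core using (_≡_; _≢_)
open import Relation.Nullary.Negation.Core using (¬_)
open import Relation.Unary using (Pred; _∈_; _∉_; ∅)

-- Cantor's pairing bijection, enumerating each antidiagonal
-- (0 , s) , (1 , s - 1) , … , (s , 0) in turn; π₁ and π₂ are its two inverses.

triangle : ℕ → ℕ
triangle zero    = zero
triangle (suc s) = suc s + triangle s

⟨_,_⟩ : ℕ → ℕ → ℕ
⟨ x , y ⟩ = triangle (x + y) + x

next : ℕ × ℕ → ℕ × ℕ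
next (x , zero)  = zero , suc x
next (x , suc y) = suc x , y

unpair : ℕ → ℕ × ℕ
unpair zero    = zero , zero
unpair (suc n) = next (unpair n)

π₁ π₂ : ℕ → ℕ
π₁ n = proj₁ (unpair n)
π₂ n = proj₂ (unpair n)

-- Texts of oracle programs: Kleene's μ-recursive schemes with an oracle query,
-- made unary by coding tuples with the pairing function.

data Program : Set where
  zero succ left right query : Program
  pair comp prec             : (f g : Program) → Program
  min                        : (f : Program) → Program

-- A unary partial function is given by its graph: F x y says F(x)↓ = y.

Partial : Set₁
Partial = Rel ℕ 0ℓ

_⟨_⟩↓=_ _⟨_⟩↓≠_ : Partial → ℕ → ℕ → Set
F ⟨ x ⟩↓= y = F x y
F ⟨ x ⟩↓≠ y = ∃[ z ] (F x z × z ≢ y)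

_⟨_⟩↓ _⟨_⟩↑ : Partial → ℕ → Set
F ⟨ x ⟩↓ = ∃[ y ] F ⟨ x ⟩↓= y
F ⟨ x ⟩↑ = ¬ (F ⟨ x ⟩↓)

-- h(x, 0) = F(x),  h(x, k + 1) = G(⟨x, ⟨k, h(x, k)⟩⟩).

primRec : Partial → Partial → ℕ → ℕ → ℕ → Set
primRec F G x zero    y = F x y
primRec F G x (suc k) y = ∃[ r ] (primRec F G x k r × G ⟨ x , ⟨ k , r ⟩ ⟩ y)

-- μy. F(⟨x, y⟩) = 0, with F required to converge at all smaller arguments.

minimum : Partial → Partial
minimum F x y =
  F ⟨ x , y ⟩ 0 × (∀ z → z < y → ∃[ k ] F ⟨ x , z ⟩ (suc k))

-- The oracle is an arbitrary subset of ℕ; a query returns the value of its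
-- characteristic function.

⟦_⟧ : Program → Pred ℕ 0ℓ → Partial
⟦ zero     ⟧ X x y = y ≡ 0
⟦ succ     ⟧ X x y = y ≡ suc x
⟦ left     ⟧ X x y = y ≡ π₁ x
⟦ right    ⟧ X x y = y ≡ π₂ x
⟦ query    ⟧ X x y = (x ∈ X × y ≡ 1) ⊎ (x ∉ X × y ≡ 0)
⟦ pair f g ⟧ X x y = ∃[ u ] ∃[ v ] (⟦ f ⟧ X x u × ⟦ g ⟧ X x v × y ≡ ⟨ u , v ⟩)
⟦ comp f g ⟧ X x y = ∃[ u ] (⟦ g ⟧ X x u × ⟦ f ⟧ X u y)
⟦ prec f g ⟧ X x y = primRec (⟦ f ⟧ X) (⟦ g ⟧ X) (π₁ x) (π₂ x) y
⟦ min f    ⟧ X x y = minimum (⟦ f ⟧ X) x y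

-- Every number ⟨t, ⟨i, j⟩⟩ codes a program: t selects the instruction, and i, j
-- code its subprograms, as far as the instruction has any.

instruction : ℕ → Program → Program → Program
instruction 0 f g = zero
instruction 1 f g = succ
instruction 2 f g = left
instruction 3 f g = right
instruction 4 f g = query
instruction 5 f g = pair f g
instruction 6 f g = comp f g
instruction 7 f g = prec f g
instruction _ f g = min f

-- The first argument only bounds the recursion depth. If t ≥ 1 then
-- i, j < ⟨t, ⟨i, j⟩⟩, and for t = 0 the subprograms are ignored, so depth
-- suc e is never exhausted when decoding e.

decodeUpTo : ℕ → ℕ → Program
decodeUpTo zero    e = zero
decodeUpTo (suc n) e =
  instruction (π₁ e) (decodeUpTo n (π₁ (π₂ e))) (decodeUpTo n (π₂ (π₂ e)))

decode : ℕ → Program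
decode e = decodeUpTo (suc e) e

φ[_] : Pred ℕ 0ℓ → ℕ → Partial
φ[ X ] e = ⟦ decode e ⟧ X

𝐌[_] : Pred ℕ 0ℓ → Pred ℕ 0ℓ
𝐌[ X ] p = φ[ X ] p ⟨ 0 ⟩↓= 1

-- As usual, the unrelativized numbering is φ_e = φ_e^∅: with the empty oracle a
-- query is just the constant 0.

φ : ℕ → Partial
φ = φ[ ∅ ]

𝐌 : Pred ℕ 0ℓ
𝐌 p = φ p ⟨ 0 ⟩↓= 1

TotalComputable : (ℕ → ℕ) → Set
TotalComputable d = ∃[ e ] ∀ n → φ e ⟨ n ⟩↓= d n

-- Properties of the adjudicator with index a over the X-standard domain
-- (ℕ, 𝐌[ X ]).

Annuls : Pred ℕ 0ℓ → ℕ → ℕ → Set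
Annuls X a p = φ[ X ] a ⟨ p ⟩↓= 1

Total Exhaustive Sound : Pred ℕ 0ℓ → ℕ → Set
Total      X a = ∀ p → φ[ X ] a ⟨ p ⟩↓
Exhaustive X a = ∀ p → Annuls X a p
Sound      X a = ∀ p → Annuls X a p → p ∉ 𝐌[ X ]

ExactlyOne : ∀ {a b c : Level} → Set a → Set b → Set c → Set (a ⊔ b ⊔ c)
ExactlyOne P Q R = (P ⊎ Q ⊎ R) × ¬ (P × Q) × ¬ (P × R) × ¬ (Q × R)

{-# OPTIONS --safe #-}
module Submission where

-- Let diag q be a code of the program that runs the program q on the constant
-- input q, and let q a be a code of the program that runs a after a program
-- computing diag. Then d a = diag (q a) runs q a on q a, that is, a on d a.
-- The construction manipulates program texts only, so it is the same for all
-- oracles; everything else follows since programs are single-valued.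

open import Defs
open import Axiom.ExcludedMiddle using (ExcludedMiddle)
open import Data.Nat.Base using (ℕ; zero; suc; _+_; _≤_; _<_; z≤n; s≤s⁻¹)
open import Data.Nat.Properties
open import Data.Product.Base using (_×_; _,_; proj₁; proj₂; ∃-syntax; uncurry)
open import Data.Sum.Base using (_⊎_; inj₁; inj₂)
open import Function.Base using (id; _∘_)
open import Function.Bundles using (_⇔_; mk⇔; Equivalence)
open import Function.Construct.Composition using (_⇔-∘_)
open import Level using (0ℓ)
open import Relation.Binary.Definitions using (tri<; tri≈; tri>)
open import Relation.Binary.PropositionalEquality
open import Relation.Nullary.Decidable.Core using (yes; no)
open import Relation.Nullary.Negation.Core using (¬_; contradiction)
open import Relation.Unary using (Pred; _∈_)

-- Cantor pairing: inverse laws and bounds.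

⟨0,suc⟩ : ∀ y → ⟨ 0 , suc y ⟩ ≡ suc ⟨ y , 0 ⟩
⟨0,suc⟩ y = begin
  suc (y + triangle y) + 0      ≡⟨ +-identityʳ _ ⟩
  suc (y + triangle y)          ≡⟨ cong suc (+-comm y (triangle y)) ⟩
  suc (triangle y + y)          ≡⟨ cong (λ s → suc (triangle s + y)) (+-identityʳ y) ⟨
  suc (triangle (y + 0) + y)    ∎
  where open ≡-Reasoning

⟨suc,⟩ : ∀ x y → ⟨ suc x , y ⟩ ≡ suc ⟨ x , suc y ⟩
⟨suc,⟩ x y = begin
  triangle (suc x + y) + suc x        ≡⟨ +-suc (triangle (suc x + y)) x ⟩
  suc (triangle (suc x + y) + x)      ≡⟨ cong (λ s → suc (triangle s + x)) (+-suc x y) ⟨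
  suc (triangle (x + suc y) + x)      ∎
  where open ≡-Reasoning

⟨next⟩ : ∀ p → uncurry ⟨_,_⟩ (next p) ≡ suc (uncurry ⟨_,_⟩ p)
⟨next⟩ (x , zero)  = ⟨0,suc⟩ x
⟨next⟩ (x , suc y) = ⟨suc,⟩ x y

⟨π₁,π₂⟩ : ∀ n → ⟨ π₁ n , π₂ n ⟩ ≡ n
⟨π₁,π₂⟩ zero    = refl
⟨π₁,π₂⟩ (suc n) = trans (⟨next⟩ (unpair n)) (cong suc (⟨π₁,π₂⟩ n))

unpair-⟨,⟩ : ∀ x y → unpair ⟨ x , y ⟩ ≡ (x , y)
unpair-⟨,⟩ x y = go ⟨ x , y ⟩ x y refl
  where
  -- The recursion is on the code: the predecessor of `(suc x , y)` is `(x , suc y)`, so neither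
  -- component decreases throughout.
  go : ∀ n x y → ⟨ x , y ⟩ ≡ n → unpair n ≡ (x , y)
  go zero    zero    zero    eq = refl
  go zero    zero    (suc y) eq = contradiction (trans (sym (⟨0,suc⟩ y)) eq) λ ()
  go zero    (suc x) y       eq = contradiction (trans (sym (⟨suc,⟩ x y)) eq) λ ()
  go (suc n) zero    (suc y) eq =
    cong next (go n y 0 (suc-injective (trans (sym (⟨0,suc⟩ y)) eq)))
  go (suc n) (suc x) y       eq =
    cong next (go n x (suc y) (suc-injective (trans (sym (⟨suc,⟩ x y)) eq)))

π₁-⟨,⟩ : ∀ x y → π₁ ⟨ x , y ⟩ ≡ x
π₁-⟨,⟩ x y = cong proj₁ (unpair-⟨,⟩ x y)

π₂-⟨,⟩ : ∀ x y → π₂ ⟨ x , y ⟩ ≡ y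
π₂-⟨,⟩ x y = cong proj₂ (unpair-⟨,⟩ x y)

n≤triangle : ∀ n → n ≤ triangle n
n≤triangle zero    = z≤n
n≤triangle (suc n) = m≤m+n (suc n) (triangle n)

x+y≤⟨x,y⟩ : ∀ x y → x + y ≤ ⟨ x , y ⟩
x+y≤⟨x,y⟩ x y = ≤-trans (n≤triangle (x + y)) (m≤m+n _ x)

π₁≤ : ∀ n → π₁ n ≤ n
π₁≤ n = subst (π₁ n ≤_) (⟨π₁,π₂⟩ n) (≤-trans (m≤m+n _ _) (x+y≤⟨x,y⟩ (π₁ n) (π₂ n)))

π₂≤ : ∀ n → π₂ n ≤ n
π₂≤ n = subst (π₂ n ≤_) (⟨π₁,π₂⟩ n) (≤-trans (m≤n+m _ _) (x+y≤⟨x,y⟩ (π₁ n) (π₂ n)))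

-- The components sum to at most the code, so a positive tag makes the bound strict. This drives the
-- descent to subprograms.
π₂< : ∀ n {t} → π₁ n ≡ suc t → π₂ n < n
π₂< n {t} eq = begin-strict
  π₂ n                ≤⟨ m≤n+m (π₂ n) t ⟩
  t + π₂ n            <⟨ n<1+n _ ⟩
  suc t + π₂ n        ≡⟨ cong (_+ π₂ n) eq ⟨
  π₁ n + π₂ n         ≤⟨ x+y≤⟨x,y⟩ (π₁ n) (π₂ n) ⟩
  ⟨ π₁ n , π₂ n ⟩     ≡⟨ ⟨π₁,π₂⟩ n ⟩
  n                   ∎
  where open ≤-Reasoning

-- Decoding and encoding of programs.

-- One unit of depth pays for one descent, since subprogram codes are smaller under a positive tag;
-- tag 0 discards them.
decodeUpTo-stable : ∀ m n e → e < m → e < n → decodeUpTo m e ≡ decodeUpTo n e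
decodeUpTo-stable (suc m) (suc n) e e<m e<n with π₁ e in eq
... | zero  = refl
... | suc t = cong₂ (instruction (suc t)) (stable _ (π₁≤ (π₂ e))) (stable _ (π₂≤ (π₂ e)))
  where
  stable : ∀ i → i ≤ π₂ e → decodeUpTo m i ≡ decodeUpTo n i
  stable i i≤ = decodeUpTo-stable m n i (<-≤-trans i<e (s≤s⁻¹ e<m)) (<-≤-trans i<e (s≤s⁻¹ e<n))
    where i<e = ≤-<-trans i≤ (π₂< e eq)

decode-instruction : ∀ t i j →
  decode ⟨ suc t , ⟨ i , j ⟩ ⟩ ≡ instruction (suc t) (decode i) (decode j)
decode-instruction t i j =
  unfold ⟨ suc t , ⟨ i , j ⟩ ⟩
    (π₁-⟨,⟩ (suc t) ⟨ i , j ⟩)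
    (trans (cong π₁ (π₂-⟨,⟩ (suc t) ⟨ i , j ⟩)) (π₁-⟨,⟩ i j))
    (trans (cong π₂ (π₂-⟨,⟩ (suc t) ⟨ i , j ⟩)) (π₂-⟨,⟩ i j))
  where
  -- With the code generalised to a variable `e`, both `i` and `j` can be replaced by projections of
  -- `e`; for the literal code this would be circular.
  unfold : ∀ e → π₁ e ≡ suc t → π₁ (π₂ e) ≡ i → π₂ (π₂ e) ≡ j →
           decode e ≡ instruction (suc t) (decode i) (decode j)
  unfold e t≡ refl refl = begin
    instruction (π₁ e) (decodeUpTo e i) (decodeUpTo e j)
      ≡⟨ cong (λ s → instruction s (decodeUpTo e i) (decodeUpTo e j)) t≡ ⟩
    instruction (suc t) (decodeUpTo e i) (decodeUpTo e j)
      ≡⟨ cong₂ (instruction (suc t)) (stable i (π₁≤ (π₂ e))) (stable j (π₂≤ (π₂ e))) ⟩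
    instruction (suc t) (decode i) (decode j) ∎
    where
    open ≡-Reasoning
    stable : ∀ k → k ≤ π₂ e → decodeUpTo e k ≡ decode k
    stable k k≤ = decodeUpTo-stable e (suc k) k (≤-<-trans k≤ (π₂< e t≡)) (n<1+n k)

decode-surjective : ∀ p → ∃[ e ] decode e ≡ p
decode-surjective = encode
  where
  node : ∀ t {f g} → ∃[ i ] decode i ≡ f → ∃[ j ] decode j ≡ g →
         ∃[ e ] decode e ≡ instruction (suc t) f g
  node t (i , refl) (j , refl) = ⟨ suc t , ⟨ i , j ⟩ ⟩ , decode-instruction t i j

  encode : ∀ p → ∃[ e ] decode e ≡ p
  encode zero       = 0 , refl
  -- `node t` produces tag `suc t`, so each argument is one below the tag in `instruction`. Operand
  -- positions that an instruction ignores hold the code 0.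
  encode succ       = node 0 (0 , refl) (0 , refl)
  encode left       = node 1 (0 , refl) (0 , refl)
  encode right      = node 2 (0 , refl) (0 , refl)
  encode query      = node 3 (0 , refl) (0 , refl)
  encode (pair f g) = node 4 (encode f) (encode g)
  encode (comp f g) = node 5 (encode f) (encode g)
  encode (prec f g) = node 6 (encode f) (encode g)
  encode (min f)    = node 7 (encode f) (0 , refl)

-- Programs are single-valued.

SingleValued : Partial → Set
SingleValued F = ∀ {x y z} → F x y → F x z → y ≡ z

primRec-singleValued : ∀ {F G} → SingleValued F → SingleValued G →
  ∀ {x} k {y z} → primRec F G x k y → primRec F G x k z → y ≡ z
primRec-singleValued F! G! zero    Fy Fz = F! Fy Fz
primRec-singleValued F! G! (suc k) (r , hr , Gy) (s , hs , Gz)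
  with refl ← primRec-singleValued F! G! k hr hs = G! Gy Gz

-- At the smaller of two distinct minima, `F` would be both 0 and a successor.
minimum-singleValued : ∀ {F} → SingleValued F → SingleValued (minimum F)
minimum-singleValued F! {y = y} {z} (Fy , below-y) (Fz , below-z) with <-cmp y z
... | tri< y<z _ _ = contradiction (F! Fy (proj₂ (below-z y y<z))) λ ()
... | tri≈ _ y≡z _ = y≡z
... | tri> _ _ z<y = contradiction (F! Fz (proj₂ (below-y z z<y))) λ ()

⟦⟧-singleValued : ∀ p X → SingleValued (⟦ p ⟧ X)
⟦⟧-singleValued zero  X refl refl = refl
⟦⟧-singleValued succ  X refl refl = refl
⟦⟧-singleValued left  X refl refl = refl
⟦⟧-singleValued right X refl refl = refl
⟦⟧-singleValued query X (inj₁ (_   , refl)) (inj₁ (_   , refl)) = refl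
⟦⟧-singleValued query X (inj₁ (x∈X , _))    (inj₂ (x∉X , _))    = contradiction x∈X x∉X
⟦⟧-singleValued query X (inj₂ (x∉X , _))    (inj₁ (x∈X , _))    = contradiction x∈X x∉X
⟦⟧-singleValued query X (inj₂ (_   , refl)) (inj₂ (_   , refl)) = refl
⟦⟧-singleValued (pair f g) X (_ , _ , fu , gv , refl) (_ , _ , fu′ , gv′ , refl) =
  cong₂ ⟨_,_⟩ (⟦⟧-singleValued f X fu fu′) (⟦⟧-singleValued g X gv gv′)
⟦⟧-singleValued (comp f g) X (_ , gu , fy) (_ , gu′ , fz)
  with refl ← ⟦⟧-singleValued g X gu gu′ = ⟦⟧-singleValued f X fy fz
⟦⟧-singleValued (prec f g) X {x} =
  primRec-singleValued (⟦⟧-singleValued f X) (⟦⟧-singleValued g X) (π₂ x)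
⟦⟧-singleValued (min f) X {x} = minimum-singleValued {⟦ f ⟧ X} (⟦⟧-singleValued f X) {x}

-- Total functions computed uniformly in the oracle.

-- One program text must serve every `X`; this makes the final `d` independent of the oracle.
record Computes (p : Program) (f : ℕ → ℕ) : Set₁ where
  constructor computes
  field graph : ∀ X x → ⟦ p ⟧ X x (f x)

open Computes using (graph)

comp-computes : ∀ {p q f g} → Computes p f → Computes q g → Computes (comp p q) (f ∘ g)
comp-computes {g = g} pf qg = computes λ X x → g x , graph qg X x , graph pf X (g x)

pair-computes : ∀ {p q f g} → Computes p f → Computes q g →
  Computes (pair p q) (λ x → ⟨ f x , g x ⟩)
pair-computes {f = f} {g} pf qg = computes λ X x →
  f x , g x , graph pf X x , graph qg X x , refl

identity : Program
identity = pair left right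

identity-computes : Computes identity id
identity-computes = computes λ X x → π₁ x , π₂ x , refl , refl , sym (⟨π₁,π₂⟩ x)

constant : ℕ → Program
constant zero    = zero
constant (suc n) = comp succ (constant n)

constant-computes : ∀ n → Computes (constant n) (λ _ → n)
constant-computes zero    = computes λ X x → refl
constant-computes (suc n) = computes λ X x → n , graph (constant-computes n) X x , refl

-- An equivalence of graphs, because `p` may diverge at `n`.
comp-constant : ∀ p n X {x y} → ⟦ comp p (constant n) ⟧ X x y ⇔ ⟦ p ⟧ X n y
comp-constant p n X {x} {y} = mk⇔ to λ py → n , graph (constant-computes n) X x , py
  where
  to : ⟦ comp p (constant n) ⟧ X x y → ⟦ p ⟧ X n y
  to (u , nu , py) with refl ← ⟦⟧-singleValued (constant n) X nu (graph (constant-computes n) X x) = py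

-- Operations on codes, and programs computing them.

compCode : ℕ → ℕ → ℕ
compCode i j = ⟨ 6 , ⟨ i , j ⟩ ⟩

decode-compCode : ∀ i j → decode (compCode i j) ≡ comp (decode i) (decode j)
decode-compCode = decode-instruction 5

compCode-computes : ∀ {p q f g} → Computes p f → Computes q g →
  Computes (pair (constant 6) (pair p q)) (λ x → compCode (f x) (g x))
compCode-computes pf qg = pair-computes (constant-computes 6) (pair-computes pf qg)

succCode : ℕ
succCode = ⟨ 1 , 0 ⟩

constantCode : ℕ → ℕ
constantCode zero    = 0
constantCode (suc n) = compCode succCode (constantCode n)

decode-constantCode : ∀ n → decode (constantCode n) ≡ constant n
decode-constantCode zero    = refl
decode-constantCode (suc n) =
  trans (decode-compCode succCode (constantCode n)) (cong (comp succ) (decode-constantCode n))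

constantCodeStep : Program
-- The input is `⟨ x , ⟨ k , r ⟩ ⟩`; `comp right right` extracts the previous value `r`.
constantCodeStep = pair (constant 6) (pair (constant succCode) (comp right right))

constantCodeStep-computes : Computes constantCodeStep (λ x → compCode succCode (π₂ (π₂ x)))
constantCodeStep-computes =
  compCode-computes (constant-computes succCode) (computes λ X x → π₂ x , refl , refl)

constantCoder : Program
-- `prec` recurses on the second component, so the input `n` is packed with a dummy parameter 0.
constantCoder = comp (prec zero constantCodeStep) (pair zero identity)

constantCoder-computes : Computes constantCoder constantCode
constantCoder-computes = computes λ X n →
  ⟨ 0 , n ⟩ , (0 , n , refl , graph identity-computes X n , refl) ,
  subst (λ k → rec X (π₁ ⟨ 0 , n ⟩) k (constantCode n)) (sym (π₂-⟨,⟩ 0 n)) (go X _ n)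
  where
  rec : Pred ℕ 0ℓ → ℕ → ℕ → ℕ → Set
  rec X = primRec (⟦ zero ⟧ X) (⟦ constantCodeStep ⟧ X)

  go : ∀ X x k → rec X x k (constantCode k)
  go X x zero    = refl
  go X x (suc k) = r , go X x k ,
    subst (λ s → ⟦ constantCodeStep ⟧ X ⟨ x , ⟨ k , r ⟩ ⟩ (compCode succCode s))
      (trans (cong π₂ (π₂-⟨,⟩ x ⟨ k , r ⟩)) (π₂-⟨,⟩ k r))
      (graph constantCodeStep-computes X ⟨ x , ⟨ k , r ⟩ ⟩)
    where r = constantCode k

-- Diagonalization.

diag : ℕ → ℕ
diag q = compCode q (constantCode q)

diagonalizer : Program
diagonalizer = pair (constant 6) (pair identity constantCoder)

diagonalizer-computes : Computes diagonalizer diag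
diagonalizer-computes = compCode-computes identity-computes constantCoder-computes

-- The inner `constant q` overwrites the input: an instance of the s-m-n theorem, uniform in the
-- oracle.
φ-diag : ∀ q X {x y} → φ[ X ] (diag q) x y ⇔ φ[ X ] q q y
φ-diag q X {x} {y} = subst (λ p → ⟦ p ⟧ X x y ⇔ φ[ X ] q q y) (sym eq) (comp-constant (decode q) q X)
  where
  eq : decode (diag q) ≡ comp (decode q) (constant q)
  eq = trans (decode-compCode q (constantCode q)) (cong (comp (decode q)) (decode-constantCode q))

-- The intermediate value exists because `f` is total, and is `f x` by single-valuedness.
φ-compCode : ∀ {p f} e → decode e ≡ p → Computes p f →
  ∀ a X {x y} → φ[ X ] (compCode a e) x y ⇔ φ[ X ] a (f x) y
φ-compCode {f = f} e refl ef a X {x} {y} =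
  subst (λ p → ⟦ p ⟧ X x y ⇔ φ[ X ] a (f x) y) (sym (decode-compCode a e))
    (mk⇔ to λ ay → f x , graph ef X x , ay)
  where
  to : ⟦ comp (decode a) (decode e) ⟧ X x y → φ[ X ] a (f x) y
  to (u , eu , ay) with refl ← ⟦⟧-singleValued (decode e) X eu (graph ef X x) = ay

computes⇒totalComputable : ∀ {p f} → Computes p f → TotalComputable f
computes⇒totalComputable {p} pf with decode-surjective p
... | e , refl = e , graph pf _

-- Recursion theorem for self-application: d a on any input does what a does on
-- d a itself. The code e of the diagonalizer is kept a variable because its
-- numeral is astronomically large.
selfApplication : ∃[ d ] (TotalComputable d ×
  (∀ a X {x y} → φ[ X ] (d a) x y ⇔ φ[ X ] a (d a) y))
selfApplication = fromCode (decode-surjective diagonalizer)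
  where
  fromCode : ∃[ e ] decode e ≡ diagonalizer →
    ∃[ d ] (TotalComputable d × (∀ a X {x y} → φ[ X ] (d a) x y ⇔ φ[ X ] a (d a) y))
  fromCode (e , e≡) =
    (λ a → diag (compCode a e)) ,
    computes⇒totalComputable
      (comp-computes diagonalizer-computes
        (compCode-computes identity-computes (constant-computes e))) ,
    λ a X → φ-compCode e e≡ diagonalizer-computes a X ⇔-∘ φ-diag (compCode a e) X

-- Trichotomy and the limits of adjudication.

↓≠⇒¬↓= : ∀ X e {x y} → φ[ X ] e ⟨ x ⟩↓≠ y → ¬ (φ[ X ] e ⟨ x ⟩↓= y)
↓≠⇒¬↓= X e (z , ez , z≢y) ey = z≢y (⟦⟧-singleValued (decode e) X ez ey)

trichotomy : ExcludedMiddle 0ℓ → ∀ X e x y →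
  ExactlyOne (φ[ X ] e ⟨ x ⟩↓= y) (φ[ X ] e ⟨ x ⟩↓≠ y) (φ[ X ] e ⟨ x ⟩↑)
trichotomy em X e x y = cases ,
  (λ (ey , e≠) → ↓≠⇒¬↓= X e e≠ ey) ,
  (λ (ey , e↑) → e↑ (y , ey)) ,
  (λ ((z , ez , _) , e↑) → e↑ (z , ez))
  where
  cases : (φ[ X ] e ⟨ x ⟩↓= y) ⊎ (φ[ X ] e ⟨ x ⟩↓≠ y) ⊎ (φ[ X ] e ⟨ x ⟩↑)
  -- Only convergence, a halting question, is decided classically; comparing the value with `y` is
  -- decidable.
  cases with em {φ[ X ] e ⟨ x ⟩↓}
  ... | no e↑ = inj₂ (inj₂ e↑)
  ... | yes (z , ez) with z ≟ y
  ...   | yes refl = inj₁ ez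
  ...   | no z≢y   = inj₂ (inj₁ (z , ez , z≢y))

corollary3p6 : (∃[ d ]
    ( TotalComputable d
    × (∀ a → (d a ∈ 𝐌) ⇔ (φ a ⟨ d a ⟩↓= 1))
    × (∀ (a : ℕ) (X : Pred ℕ 0ℓ) →
    ((d a ∈ 𝐌[ X ]) ⇔ (φ[ X ] a ⟨ d a ⟩↓= 1))
    × (ExcludedMiddle 0ℓ →
    ExactlyOne (φ[ X ] a ⟨ d a ⟩↓= 1)
    (φ[ X ] a ⟨ d a ⟩↓≠ 1)
    (φ[ X ] a ⟨ d a ⟩↑))
    × (φ[ X ] a ⟨ d a ⟩↓= 1 → ¬ Sound X a)
    × (φ[ X ] a ⟨ d a ⟩↓≠ 1 → ¬ Exhaustive X a)
    × (φ[ X ] a ⟨ d a ⟩↑ → ¬ Total X a))))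
    × (∀ (X : Pred ℕ 0ℓ) → ¬ (∃[ a ] (Total X a × Exhaustive X a × Sound X a)))
corollary3p6 =
  let d , d-computable , d-self = selfApplication
      unsound : ∀ a X → φ[ X ] a ⟨ d a ⟩↓= 1 → ¬ Sound X a
      -- Annulling `d a` makes `d a` output 1 on input 0, which puts it in `𝐌[ X ]`.
      unsound a X a↓1 sound = sound (d a) a↓1 (Equivalence.from (d-self a X) a↓1)
  in
  ( d
  , d-computable
  -- The unrelativized claim is the case of the empty oracle.
  , (λ a → d-self a _)
  , λ a X →
      d-self a X
    , (λ em → trichotomy em X a (d a) 1)
    , unsound a X
    , (λ a≠1 exhaustive → ↓≠⇒¬↓= X a a≠1 (exhaustive (d a)))
    , (λ a↑ total → a↑ (total (d a)))
  ) , λ X (a , _ , exhaustive , sound) → unsound a X (exhaustive (d a)) sound
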